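{- For all ordered graphs $G_1$ and $G_2$, $$r_o(G_1,G_2)\;\ge\;\frac14\min\Big\{\Delta^-(G_1)\big(\Delta^-(G_1)-1\big),\ \Delta^+(G_2)\big(\Delta^+(G_2)-1\big)\Big\}.$$
   Context: An ordered graph $G$ on $n$ vertices has vertex set $[n]=\{1,\dots,n\}$ with the natural linear order. An ordered graph $G$ on $[n]$ is contained in an ordered graph $H$ on a linearly ordered vertex set if there is an injective map $f$ from $[n]$ to $V(H)$ with $f(i)<f(j)$ whenever $i<j$ and $f(i)f(j)\in E(H)$ whenever $ij\in E(G)$; such an image is an ordered copy of $G$. For a vertex $v$ of an ordered graph, the left degree $d^-(v)$ is the number of neighbors $u$ of $v$ with $u<v$, and the right degree $d^+(v)$ is the number of neighbors $u$ with $u>v$; $\Delta^-(G)$ and $\Delta^+(G)$ denote the maxima of $d^-$ and $d^+$ over $V(G)$. The online ordered Ramsey game for $(G_1,G_2)$ is played by Builder and Painter on the vertex set $\mathbb N$ with its natural order. On each turn Builder selects a previously unselected pair of vertices (an edge) and Painter then colors it red or blue. Builder wins as soon as the colored edges contain an ordered red copy of $G_1$ or an ordered blue copy of $G_2$; Builder tries to minimize and Painter tries to maximize the number of turns. The online ordered Ramsey number $r_o(G_1,G_2)$ is the number of turns after which Builder wins when both players play optimally. -}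

module Defs where

open import Data.Nat using (ℕ; suc; _≤_; _<_)
import Data.Nat.Properties as ℕ
open import Data.Fin using (Fin) renaming (_<_ to _<ᶠ_)
import Data.Fin.Properties as Fin
open import Data.List using (List; []; _∷_; length; filter; map; allFin)
open import Data.List.Extrema.Nat using (max)
open import Data.List.Membership.Propositional using (_∉_)
open import Data.List.Relation.Unary.Any as Any using (Any; any?)
open import Data.Product using (_×_; _,_; proj₁; ∃-syntax)
open import Data.Sum as Sum using (_⊎_; inj₁; inj₂)
open import Function.Definitions using (Injective)
open import Level using (0ℓ)
open import Relation.Binary.Core using (Rel)
open import Relation.Binary.Definitions using (Symmetric; Decidable; DecidableEquality)
open import Relation.Binary.PropositionalEquality using (_≡_; refl)
open import Relation.Nullary using (¬_; Dec; yes; no)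
open import Relation.Nullary.Decidable using (_×-dec_; _⊎-dec_; recompute)

record Graph (V : Set) : Set₁ where
  field
    Adj    : Rel V 0ℓ
    adj?   : Decidable Adj
    sym    : Symmetric Adj
    irrefl : ∀ {v} → ¬ Adj v v

OrderedGraph : ℕ → Set₁
OrderedGraph n = Graph (Fin n)

module _ {n : ℕ} (G : OrderedGraph n) where
  open Graph G

  d⁻ : Fin n → ℕ
  d⁻ v = length (filter (λ u → (u Fin.<? v) ×-dec adj? u v) (allFin n))

  d⁺ : Fin n → ℕ
  d⁺ v = length (filter (λ u → (v Fin.<? u) ×-dec adj? u v) (allFin n))

  -- For the graph with no vertices both maxima are 0.
  Δ⁻ : ℕ
  Δ⁻ = max 0 (map d⁻ (allFin n))

  Δ⁺ : ℕ
  Δ⁺ = max 0 (map d⁺ (allFin n))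

record OrderedCopy {n : ℕ} (G : OrderedGraph n) (H : Graph ℕ) : Set where
  field
    f         : Fin n → ℕ
    injective : Injective _≡_ _≡_ f
    monotone  : ∀ {i j} → i <ᶠ j → f i < f j
    edge      : ∀ {i j} → Graph.Adj G i j → Graph.Adj H (f i) (f j)

data Colour : Set where
  red blue : Colour

_≟ᶜ_ : DecidableEquality Colour
red  ≟ᶜ red  = yes refl
red  ≟ᶜ blue = no λ ()
blue ≟ᶜ red  = no λ ()
blue ≟ᶜ blue = yes refl

-- An unordered pair of distinct vertices, stored with the smaller one first;
-- the proof is irrelevant, so _≡_ on Edge is equality of pairs.
record Edge : Set where
  constructor edge
  field
    lo hi  : ℕ
    .lo<hi : lo < hi

open Edge

Position : Set
Position = List (Edge × Colour)

Joins : Edge → ℕ → ℕ → Set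
Joins e u v = (lo e ≡ u × hi e ≡ v) ⊎ (lo e ≡ v × hi e ≡ u)

colourClass : Colour → Position → Graph ℕ
colourClass c p = record
  { Adj    = λ u v → Any (Connects u v) p
  ; adj?   = λ u v → any? (connects? u v) p
  ; sym    = Any.map (λ { (eq , j) → eq , Sum.swap j })
  ; irrefl = λ a → loopless (Any.satisfied a)
  }
  where
  Connects : ℕ → ℕ → Edge × Colour → Set
  Connects u v (e , c′) = c′ ≡ c × Joins e u v

  connects? : ∀ u v ec → Dec (Connects u v ec)
  connects? u v (e , c′) =
    (c′ ≟ᶜ c) ×-dec
    (((lo e ℕ.≟ u) ×-dec (hi e ℕ.≟ v)) ⊎-dec ((lo e ℕ.≟ v) ×-dec (hi e ℕ.≟ u)))

  no-loop : ∀ e {v} → ¬ (lo e ≡ v × hi e ≡ v)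
  no-loop (edge l h l<h) (refl , refl) = ℕ.<-irrefl refl (recompute (l ℕ.<? h) l<h)

  loopless : ∀ {v} → ¬ (∃[ ec ] Connects v v ec)
  loopless ((e , _) , _ , inj₁ j) = no-loop e j
  loopless ((e , _) , _ , inj₂ j) = no-loop e j

module _ {n₁ n₂ : ℕ} (G₁ : OrderedGraph n₁) (G₂ : OrderedGraph n₂) where

  Won : Position → Set
  Won p = OrderedCopy G₁ (colourClass red p) ⊎ OrderedCopy G₂ (colourClass blue p)

  -- BuilderWins t p: from position p Builder can force a win within t further
  -- turns, whatever colours Painter chooses.
  data BuilderWins : ℕ → Position → Set where
    won  : ∀ {t p} → Won p → BuilderWins t p
    turn : ∀ {t p} (e : Edge) → e ∉ map proj₁ p →
           (∀ c → BuilderWins t ((e , c) ∷ p)) → BuilderWins (suc t) p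

  -- r = r_o(G₁ , G₂), as a relation since the existence of the value is itself
  -- a theorem (it follows from Ramsey's theorem).
  IsOnlineOrderedRamseyNumber : ℕ → Set
  IsOnlineOrderedRamseyNumber r =
    BuilderWins r [] × (∀ t → BuilderWins t [] → r ≤ t)

{-# OPTIONS --safe #-}
-- Let a = Δ⁻(G₁) ≥ 1 and b = Δ⁺(G₂).  Painter colours an edge red unless its
-- larger endpoint already has a − 1 red edges to its left.  No vertex then
-- reaches red left degree a, so Builder must complete a blue copy of G₂, hence
-- a vertex with b blue edges to its right.  The other end of each of these b
-- edges is the larger endpoint of a − 1 red edges and of the blue edge itself,
-- and these b groups of edges are disjoint; hence at least a b turns were played.
module Submission where

open import Data.Fin using (Fin) renaming (_<_ to _<ᶠ_)
open import Data.List using (List; []; _∷_; length; filter; map; allFin)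
open import Data.List.Extrema.Nat using (max; argmax-all)
open import Data.List.Membership.Propositional using (_∈_; find; lose)
open import Data.List.Membership.Propositional.Properties using (∈-filter⁺)
open import Data.List.Properties using (length-map; filter-some; filter-notAll; filter-accept; filter-reject)
open import Data.List.Relation.Unary.All as All using (All; []; _∷_)
import Data.List.Relation.Unary.All.Properties as All
open import Data.List.Relation.Unary.AllPairs using ([]; _∷_)
open import Data.List.Relation.Unary.Any using (here; there)
open import Data.List.Relation.Unary.Unique.Propositional using (Unique)
import Data.List.Relation.Unary.Unique.Propositional.Properties as Unique
open import Data.Nat using (ℕ; zero; suc; _+_; _*_; _∸_; _⊓_; _≤_; _<_; z≤n)
open import Data.Nat.Properties
open import Data.Product using (_×_; _,_; proj₁; ∃-syntax)
open import Data.Sum using (inj₁; inj₂)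
open import Function using (_∘_; id)
open import Function.Definitions using (Injective)
open import Level using (0ℓ)
open import Relation.Binary.PropositionalEquality using (_≡_; _≢_; refl; sym; trans; cong; subst)
open import Relation.Nullary using (yes; no; ¬?; contradiction)
open import Relation.Nullary.Decidable using (recompute)
open import Relation.Unary using (Pred; Decidable; _⊆_)
open import Defs

open Edge

module _ {A : Set} where

  length-filter-¬ : {P : Pred A 0ℓ} (P? : Decidable P) (xs : List A) →
    length (filter P? xs) + length (filter (¬? ∘ P?) xs) ≡ length xs
  length-filter-¬ P? []       = refl
  length-filter-¬ P? (x ∷ xs) with P? x
  ... | yes _ = cong suc (length-filter-¬ P? xs)
  ... | no  _ = trans (+-suc _ _) (cong suc (length-filter-¬ P? xs))

  filter-filter-⊆ : {P Q : Pred A 0ℓ} (P? : Decidable P) (Q? : Decidable Q) → Q ⊆ P →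
    ∀ xs → filter Q? (filter P? xs) ≡ filter Q? xs
  filter-filter-⊆ P? Q? Q⊆P []       = refl
  filter-filter-⊆ P? Q? Q⊆P (x ∷ xs) with P? x
  ... | no ¬px = trans (filter-filter-⊆ P? Q? Q⊆P xs) (sym (filter-reject Q? (¬px ∘ Q⊆P)))
  ... | yes _  with Q? x
  ...   | yes _ = cong (x ∷_) (filter-filter-⊆ P? Q? Q⊆P xs)
  ...   | no  _ = filter-filter-⊆ P? Q? Q⊆P xs

  module _ (key : A → ℕ) where

    fibre : List A → ℕ → List A
    fibre xs v = filter (λ x → key x ≟ v) xs

    -- Fibres over distinct values are disjoint: splitting off the fibre over the head `v` removes
    -- at least `k` entries and leaves every other fibre intact.
    length-fibres : ∀ {k vs} xs → Unique vs → All (λ v → k ≤ length (fibre xs v)) vs →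
      length vs * k ≤ length xs
    length-fibres             xs []          []           = z≤n
    length-fibres {k} {v ∷ _} xs (v∉vs ∷ u) (k≤v ∷ k≤vs) =
      subst (_ ≤_) (length-filter-¬ (λ x → key x ≟ v) xs)
        (+-mono-≤ k≤v (length-fibres rest u (All.zipWith transfer (v∉vs , k≤vs))))
      where
      rest : List A
      rest = filter (λ x → ¬? (key x ≟ v)) xs

      transfer : ∀ {w} → v ≢ w × k ≤ length (fibre xs w) → k ≤ length (fibre rest w)
      transfer {w} (v≢w , k≤w) = subst (λ ys → k ≤ length ys)
        (sym (filter-filter-⊆ (λ x → ¬? (key x ≟ v)) (λ x → key x ≟ w)
          (λ kx≡w kx≡v → v≢w (trans (sym kx≡v) kx≡w)) xs))
        k≤w

    -- Injectivity makes the values `f u` distinct. When `P` selects the neighbours on one side of a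
    -- vertex, the left factor is its left or right degree.
    length-filter-fibres : ∀ {n k} {P : Pred (Fin n) 0ℓ} (P? : Decidable P)
      (f : Fin n → ℕ) → Injective _≡_ _≡_ f → (xs : List A) →
      (∀ u → P u → k ≤ length (fibre xs (f u))) →
      length (filter P? (allFin n)) * k ≤ length xs
    length-filter-fibres {n} {k} P? f f-inj xs large =
      subst (λ l → l * k ≤ length xs) (length-map f S)
        (length-fibres xs
          (Unique.map⁺ f-inj (Unique.filter⁺ P? (Unique.allFin⁺ n)))
          (All.map⁺ (All.map (large _) (All.all-filter P? (allFin n)))))
      where
      S : List (Fin n)
      S = filter P? (allFin n)

-- The maximum is one of the listed values or the default 0, the latter being forced when there are
-- no vertices.
max-allFin : ∀ {n} {P : Pred ℕ 0ℓ} (d : Fin n → ℕ) → P 0 → (∀ v → P (d v)) →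
  P (max 0 (map d (allFin n)))
max-allFin {n} {P} d p₀ pd = argmax-all id {P = P} p₀ (All.map⁺ (All.universal pd (allFin n)))

-- Adjacency admits both orientations; `u < v` excludes the swapped one. The irrelevant proof of
-- `l < h` is recovered by deciding it.
colourClass-edge : ∀ {c p u v} → u < v → Graph.Adj (colourClass c p) u v →
  ∃[ e ] (e , c) ∈ p × lo e ≡ u × hi e ≡ v
colourClass-edge u<v a with find a
... | (e , _) , e∈p , refl , inj₁ (lo≡u , hi≡v) = e , e∈p , lo≡u , hi≡v
... | (edge l h l<h , _) , _ , _ , inj₂ (refl , refl) =
  contradiction (recompute (l <? h) l<h) (<-asym u<v)

endingAt : Position → ℕ → Position
endingAt = fibre (hi ∘ proj₁)

Red : Pred (Edge × Colour) 0ℓ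
Red (_ , c) = c ≡ red

red? : Decidable Red
red? (_ , c) = c ≟ᶜ red

redEndingAt : Position → ℕ → Position
redEndingAt p v = filter red? (endingAt p v)

redLeftDegree : Position → ℕ → ℕ
redLeftDegree p v = length (redEndingAt p v)

-- `k` is Painter's cap on red left degrees. `blue≥` says that blue edges end only at saturated
-- vertices.
record Invariant (k : ℕ) (p : Position) : Set where
  field
    red≤  : ∀ v → redLeftDegree p v ≤ k
    blue≥ : ∀ {e} → (e , blue) ∈ p → k ≤ redLeftDegree p (hi e)

open Invariant

module _ {n k : ℕ} (G : OrderedGraph n) {p : Position} (inv : Invariant k p) where

  Δ⁻-red-copy : OrderedCopy G (colourClass red p) → Δ⁻ G ≤ k
  Δ⁻-red-copy copy = max-allFin {P = _≤ k} (d⁻ G) z≤n λ x → begin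
    -- The factor 1 counts one red edge per left neighbour: distinct neighbours give distinct lower
    -- endpoints.
    d⁻ G x                ≡⟨ *-identityʳ _ ⟨
    d⁻ G x * 1            ≤⟨ length-filter-fibres (lo ∘ proj₁) _ f injective (redEndingAt p (f x)) (neighbour x) ⟩
    redLeftDegree p (f x) ≤⟨ red≤ inv (f x) ⟩
    k                     ∎
    where
    open ≤-Reasoning
    open OrderedCopy copy renaming (edge to adjacent)
    neighbour : ∀ x u → u <ᶠ x × Graph.Adj G u x →
      1 ≤ length (fibre (lo ∘ proj₁) (redEndingAt p (f x)) (f u))
    neighbour x u (u<x , a) with colourClass-edge (monotone u<x) (adjacent a)
    ... | e , e∈p , lo≡ , hi≡ = filter-some _ (lose (∈-filter⁺ red? (∈-filter⁺ _ e∈p hi≡) refl) lo≡)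

  -- Grouping edges by larger endpoint keeps the groups of different right neighbours of `x`
  -- disjoint.
  Δ⁺-blue-copy : OrderedCopy G (colourClass blue p) → Δ⁺ G * suc k ≤ length p
  Δ⁺-blue-copy copy = max-allFin {P = λ d → d * suc k ≤ length p} (d⁺ G) z≤n λ x →
    length-filter-fibres (hi ∘ proj₁) _ f injective p (neighbour x)
    where
    open OrderedCopy copy renaming (edge to adjacent)
    neighbour : ∀ x u → x <ᶠ u × Graph.Adj G u x → suc k ≤ length (endingAt p (f u))
    neighbour x u (x<u , a) with colourClass-edge (monotone x<u) (adjacent (Graph.sym G a))
    -- The blue edge itself ends at `f u` and is dropped by the red filter, so the inequality is
    -- strict and yields `suc k`.
    ... | e , e∈p , _ , hi≡ = ≤-<-trans
      (subst (λ v → k ≤ redLeftDegree p v) hi≡ (blue≥ inv e∈p))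
      (filter-notAll red? _ (lose (∈-filter⁺ _ e∈p hi≡) λ ()))

module _ (p : Position) (e : Edge) where

  redLeftDegree-red-hi : redLeftDegree ((e , red) ∷ p) (hi e) ≡ suc (redLeftDegree p (hi e))
  redLeftDegree-red-hi = cong (length ∘ filter red?) (filter-accept (λ x → hi (proj₁ x) ≟ hi e) refl)

  redLeftDegree-≢hi : ∀ {c v} → hi e ≢ v → redLeftDegree ((e , c) ∷ p) v ≡ redLeftDegree p v
  redLeftDegree-≢hi {v = v} hi≢v =
    cong (length ∘ filter red?) (filter-reject (λ x → hi (proj₁ x) ≟ v) hi≢v)

  redLeftDegree-blue : ∀ v → redLeftDegree ((e , blue) ∷ p) v ≡ redLeftDegree p v
  redLeftDegree-blue v with hi e ≟ v
  ... | yes refl = cong (length ∘ filter red?) (filter-accept (λ x → hi (proj₁ x) ≟ v) refl)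
  ... | no hi≢v = redLeftDegree-≢hi hi≢v

  redLeftDegree-mono : ∀ v → redLeftDegree p v ≤ redLeftDegree ((e , red) ∷ p) v
  redLeftDegree-mono v with hi e ≟ v
  ... | yes refl = ≤-trans (n≤1+n _) (≤-reflexive (sym redLeftDegree-red-hi))
  ... | no hi≢v = ≤-reflexive (sym (redLeftDegree-≢hi hi≢v))

-- The reply is red exactly while the larger endpoint is below the cap; later edges never lower a
-- red degree, so saturation persists.
painter-reply : ∀ {k p} → Invariant k p → ∀ e → ∃[ c ] Invariant k ((e , c) ∷ p)
painter-reply {k} {p} inv e with redLeftDegree p (hi e) <? k
... | yes small = red , record
  { red≤  = bound
  ; blue≥ = λ { (there e∈p) → ≤-trans (blue≥ inv e∈p) (redLeftDegree-mono p e _) }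
  }
  where
  bound : ∀ v → redLeftDegree ((e , red) ∷ p) v ≤ k
  bound v with hi e ≟ v
  ... | yes refl = ≤-trans (≤-reflexive (redLeftDegree-red-hi p e)) small
  ... | no hi≢v = ≤-trans (≤-reflexive (redLeftDegree-≢hi p e hi≢v)) (red≤ inv v)
... | no ¬small = blue , record
  { red≤  = λ v → ≤-trans (≤-reflexive (redLeftDegree-blue p e v)) (red≤ inv v)
  ; blue≥ = λ e∈p → ≤-trans (old e∈p) (≤-reflexive (sym (redLeftDegree-blue p e _)))
  }
  where
  old : ∀ {e′} → (e′ , blue) ∈ (e , blue) ∷ p → k ≤ redLeftDegree p (hi e′)
  old (here refl)  = ≮⇒≥ ¬small
  old (there e∈p) = blue≥ inv e∈p

module _ {n₁ n₂ : ℕ} (G₁ : OrderedGraph n₁) (G₂ : OrderedGraph n₂) where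

  -- Each turn lengthens `p` by one and lowers `t` by one, so the right side is constant along the
  -- play that follows Painter's replies.
  builder-needs : ∀ {k t p} → k < Δ⁻ G₁ → Invariant k p → BuilderWins G₁ G₂ t p →
    Δ⁺ G₂ * suc k ≤ length p + t
  builder-needs k<Δ inv (won (inj₁ copy)) =
    contradiction (Δ⁻-red-copy G₁ inv copy) (<⇒≱ k<Δ)
  builder-needs k<Δ inv (won (inj₂ copy)) =
    m≤n⇒m≤n+o _ (Δ⁺-blue-copy G₂ inv copy)
  builder-needs {p = p} k<Δ inv (turn {t} e _ wins) with painter-reply inv e
  ... | c , inv′ =
    ≤-trans (builder-needs k<Δ inv′ (wins c)) (≤-reflexive (sym (+-suc (length p) t)))

  Δ⁻*Δ⁺≤turns : ∀ {t} → BuilderWins G₁ G₂ t [] → Δ⁻ G₁ * Δ⁺ G₂ ≤ t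
  Δ⁻*Δ⁺≤turns wins with Δ⁻ G₁ in eq
  ... | zero  = z≤n
  -- The cap is one below `Δ⁻ G₁`: a red copy stays impossible, and each group has size `suc k`,
  -- which is `Δ⁻ G₁`.
  ... | suc k = ≤-trans (≤-reflexive (*-comm (suc k) (Δ⁺ G₂)))
    (builder-needs (≤-reflexive (sym eq)) (record { red≤ = λ _ → z≤n ; blue≥ = λ () }) wins)

[a*pred-a]⊓[b*pred-b]≤a*b : ∀ a b → (a * (a ∸ 1)) ⊓ (b * (b ∸ 1)) ≤ a * b
[a*pred-a]⊓[b*pred-b]≤a*b a b with ≤-total a b
... | inj₁ a≤b = ≤-trans (m⊓n≤m _ _) (*-monoʳ-≤ a (≤-trans (m∸n≤m a 1) a≤b))
... | inj₂ b≤a = ≤-trans (m⊓n≤n (a * (a ∸ 1)) _) (*-mono-≤ b≤a (m∸n≤m b 1))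

theorem3 : ∀ {n₁ n₂ : ℕ} (G₁ : OrderedGraph n₁) (G₂ : OrderedGraph n₂) (r : ℕ) →
    IsOnlineOrderedRamseyNumber G₁ G₂ r →
    (Δ⁻ G₁ * (Δ⁻ G₁ ∸ 1)) ⊓ (Δ⁺ G₂ * (Δ⁺ G₂ ∸ 1)) ≤ 4 * r
theorem3 G₁ G₂ r (wins , _) = begin
  (Δ⁻ G₁ * (Δ⁻ G₁ ∸ 1)) ⊓ (Δ⁺ G₂ * (Δ⁺ G₂ ∸ 1)) ≤⟨ [a*pred-a]⊓[b*pred-b]≤a*b (Δ⁻ G₁) (Δ⁺ G₂) ⟩
  Δ⁻ G₁ * Δ⁺ G₂                                   ≤⟨ Δ⁻*Δ⁺≤turns G₁ G₂ wins ⟩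
  -- The bound obtained is stronger by a factor 4, which is given away here.
  r                                               ≤⟨ m≤n*m r 4 ⟩
  4 * r                                           ∎
  where open ≤-Reasoning
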